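{- Let $H$ be a homogeneous relation on a finite set $V$, given as input by the list, for each $v\in V$, of the partition of $V\setminus\{v\}$ into equivalence classes of $H_v$, and let $S\subseteq V$ be nonempty. There is an algorithm computing $SHS(S)$, the smallest homogeneous set containing $S$ (the intersection of all homogeneous sets containing $S$), in $O(|V|\cdot|SHS(S)|)=O(|V|^2)$ time.
   Context: $V$ is a finite set. A reflectless triple is a triple $(x,y,z)\in V^3$ with $x\neq y$ and $x\neq z$, written $(x|yz)$. A homogeneous relation $H$ on $V$ is a set of reflectless triples (we write $H(s|xy)$ when $(s|xy)\in H$) such that for every $s\in V$ the binary relation $H_s=\{(x,y): H(s|xy)\}$ is an equivalence relation on $V\setminus\{s\}$. For $X\subseteq V$ and $s\notin X$, $s$ distinguishes $X$ if there are $x,y\in X$ with not $H(s|xy)$. A homogeneous set is a nonempty $M\subseteq V$ such that no element of $V\setminus M$ distinguishes $M$. The family of homogeneous sets is closed under intersection of overlapping sets and contains $V$, so $SHS(S)$ is well defined. -}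

module Defs where

open import Data.Bool.Base using (Bool; true; false; if_then_else_)
open import Data.Nat.Base using (ℕ; zero; suc; _+_; _≡ᵇ_; _<ᵇ_)
open import Data.Fin.Base using (Fin; toℕ)
open import Data.Fin.Properties using (any?; all?)
open import Data.Fin.Subset
  using (Subset; Side; inside; outside; _∈_; _∉_; _⊆_; Nonempty; ⋂)
open import Data.Fin.Subset.Properties
  using (_∈?_; _⊆?_; nonempty?; x∈p∩q⁺; x∈p∩q⁻; ∈⊤)
open import Data.List.Base using (List; []; _∷_; map; _++_; filter; length)
import Data.List.Base as List
open import Data.List.Membership.Propositional using () renaming (_∈_ to _∈ˡ_)
open import Data.List.Membership.Propositional.Properties
  using (∈-map⁺; ∈-++⁺ˡ; ∈-++⁺ʳ; ∈-filter⁺; ∈-filter⁻)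
open import Data.List.Relation.Unary.Any using (here; there)
open import Data.List.Relation.Unary.Unique.Propositional using (Unique)
open import Data.Product.Base using (Σ; ∃-syntax; _×_; _,_; proj₁; proj₂)
open import Data.Vec.Base using ([]; _∷_; lookup)
open import Function.Bundles using (_⇔_)
open import Relation.Binary.PropositionalEquality using (_≡_; _≢_; refl)
open import Relation.Binary.Structures using (IsEquivalence)
open import Relation.Nullary using (¬_; Dec)
open import Relation.Nullary.Decidable using (¬?; _×-dec_; _→-dec_; decidable-stable)
open import Relation.Unary using (Decidable)

------------------------------------------------------------------------
-- Homogeneous relations on V = Fin n, and homogeneous sets

record HomogeneousRelation (n : ℕ) : Set₁ where
  field
    -- Holds s x y is the membership of the triple (s|xy).  As V is finite,
    -- a set of triples has decidable membership.
    Holds       : Fin n → Fin n → Fin n → Set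
    holds?      : ∀ s x y → Dec (Holds s x y)
    reflectless : ∀ {s x y} → Holds s x y → s ≢ x × s ≢ y
    equivalence : ∀ s → IsEquivalence {A = Σ (Fin n) (s ≢_)}
                          (λ x y → Holds s (proj₁ x) (proj₁ y))

module _ {n : ℕ} (H : HomogeneousRelation n) where
  open HomogeneousRelation H

  -- Only meaningful for s ∉ X.
  Distinguishes : Fin n → Subset n → Set
  Distinguishes s X = ∃[ x ] ∃[ y ] (x ∈ X × y ∈ X × ¬ Holds s x y)

  Homogeneous : Subset n → Set
  Homogeneous M = Nonempty M × (∀ s → s ∉ M → ¬ Distinguishes s M)

  distinguishes? : ∀ s X → Dec (Distinguishes s X)
  distinguishes? s X = any? λ x → any? λ y →
    (x ∈? X) ×-dec (y ∈? X) ×-dec ¬? (holds? s x y)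

  homogeneous? : Decidable Homogeneous
  homogeneous? M =
    nonempty? M ×-dec all? λ s → ¬? (s ∈? M) →-dec ¬? (distinguishes? s M)

allSubsets : ∀ n → List (Subset n)
allSubsets zero    = [] ∷ []
allSubsets (suc n) = map (inside ∷_) (allSubsets n) ++ map (outside ∷_) (allSubsets n)

homogeneousSupersets : ∀ {n} → HomogeneousRelation n → Subset n → List (Subset n)
homogeneousSupersets {n} H S =
  filter (λ M → homogeneous? H M ×-dec (S ⊆? M)) (allSubsets n)

SHS : ∀ {n} → HomogeneousRelation n → Subset n → Subset n
SHS H S = ⋂ (homogeneousSupersets H S)

∈-allSubsets : ∀ {n} (M : Subset n) → M ∈ˡ allSubsets n
∈-allSubsets []             = here refl
∈-allSubsets (inside  ∷ M) = ∈-++⁺ˡ (∈-map⁺ (inside ∷_) (∈-allSubsets M))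
∈-allSubsets (outside ∷ M) =
  ∈-++⁺ʳ (map (inside ∷_) (allSubsets _)) (∈-map⁺ (outside ∷_) (∈-allSubsets M))

x∈⋂⁺ : ∀ {n} {x : Fin n} Ms → (∀ M → M ∈ˡ Ms → x ∈ M) → x ∈ ⋂ Ms
x∈⋂⁺ []       h = ∈⊤
x∈⋂⁺ (M ∷ Ms) h = x∈p∩q⁺ (h M (here refl) , x∈⋂⁺ Ms (λ N N∈ → h N (there N∈)))

x∈⋂⁻ : ∀ {n} {x : Fin n} Ms → x ∈ ⋂ Ms → ∀ M → M ∈ˡ Ms → x ∈ M
x∈⋂⁻ (M ∷ Ms) x∈ _ (here refl) = proj₁ (x∈p∩q⁻ M (⋂ Ms) x∈)
x∈⋂⁻ (M ∷ Ms) x∈ N (there N∈)  = x∈⋂⁻ Ms (proj₂ (x∈p∩q⁻ M (⋂ Ms) x∈)) N N∈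

module _ {n : ℕ} (H : HomogeneousRelation n) (S : Subset n) where

  x∈SHS⁺ : ∀ {x} → (∀ M → Homogeneous H M → S ⊆ M → x ∈ M) → x ∈ SHS H S
  x∈SHS⁺ h = x∈⋂⁺ (homogeneousSupersets H S) λ M M∈ →
    let _ , hom , S⊆M = ∈-filter⁻ (λ M → homogeneous? H M ×-dec (S ⊆? M)) {xs = allSubsets n} M∈
    in h M hom S⊆M

  x∈SHS⁻ : ∀ {x} → x ∈ SHS H S → ∀ M → Homogeneous H M → S ⊆ M → x ∈ M
  x∈SHS⁻ x∈ M hom S⊆M = x∈⋂⁻ (homogeneousSupersets H S) x∈ M
    (∈-filter⁺ (λ M → homogeneous? H M ×-dec (S ⊆? M)) (∈-allSubsets M) (hom , S⊆M))

  S⊆SHS : S ⊆ SHS H S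
  S⊆SHS x∈S = x∈SHS⁺ λ M hom S⊆M → S⊆M x∈S

  -- With x∈SHS⁻ this says that SHS H S is the smallest homogeneous set
  -- containing S.
  SHS-homogeneous : Nonempty S → Homogeneous H (SHS H S)
  SHS-homogeneous (a , a∈S) = (a , S⊆SHS a∈S) , λ where
    s s∉ (x , y , x∈ , y∈ , ¬sxy) → s∉ (x∈SHS⁺ λ M hom S⊆M →
      decidable-stable (s ∈? M) λ s∉M → proj₂ hom s s∉M
        (x , y , x∈SHS⁻ x∈ M hom S⊆M , x∈SHS⁻ y∈ M hom S⊆M , ¬sxy))

------------------------------------------------------------------------
-- The input: for each v, the classes of H_v

-- C is an equivalence class of H_v.
IsClass : ∀ {n} → HomogeneousRelation n → Fin n → Subset n → Set
IsClass H v C = ∃[ x ] (v ≢ x × (∀ y → y ∈ C ⇔ HomogeneousRelation.Holds H v x y))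

record PartitionLists {n : ℕ} (H : HomogeneousRelation n) : Set where
  field
    classes  : Fin n → List (Subset n)
    complete : ∀ v C → C ∈ˡ classes v ⇔ IsClass H v C
    unique   : ∀ v → Unique (classes v)

------------------------------------------------------------------------
-- A uniform-cost random-access machine, programmed in structured form.
--
-- The only arithmetic operation is the successor, so a number computed within
-- t units of time exceeds by at most t some program constant or some number
-- initially in memory; long words cannot be used to save time.

record Store : Set where
  constructor store
  field
    scalar : ℕ → ℕ              -- scalar variables, by number
    vector : ℕ → ℕ → ℕ          -- one-dimensional arrays, by number
    matrix : ℕ → ℕ → ℕ → ℕ      -- two-dimensional arrays, by number

open Store public

_[_↦_] : {A : Set} → (ℕ → A) → ℕ → A → (ℕ → A)
(f [ i ↦ a ]) j = if j ≡ᵇ i then a else f j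

data Expr : Set where
  lit  : ℕ → Expr
  var  : ℕ → Expr
  vec  : ℕ → Expr → Expr
  mat  : ℕ → Expr → Expr → Expr
  succ : Expr → Expr

data Test : Set where
  _≐_ _≺_ : Expr → Expr → Test

infix 5 _≐_ _≺_

data Program : Set where
  skip  : Program
  var≔  : ℕ → Expr → Program
  vec≔  : ℕ → Expr → Expr → Program
  mat≔  : ℕ → Expr → Expr → Expr → Program
  _⨾_   : Program → Program → Program
  cond  : Test → Program → Program → Program
  while : Test → Program → Program

infixr 4 _⨾_

⟦_⟧ : Expr → Store → ℕ
⟦ lit k ⟧       σ = k
⟦ var x ⟧       σ = scalar σ x
⟦ vec a e ⟧     σ = vector σ a (⟦ e ⟧ σ)
⟦ mat a e₁ e₂ ⟧ σ = matrix σ a (⟦ e₁ ⟧ σ) (⟦ e₂ ⟧ σ)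
⟦ succ e ⟧      σ = suc (⟦ e ⟧ σ)

⟦_⟧ᵗ : Test → Store → Bool
⟦ e₁ ≐ e₂ ⟧ᵗ σ = ⟦ e₁ ⟧ σ ≡ᵇ ⟦ e₂ ⟧ σ
⟦ e₁ ≺ e₂ ⟧ᵗ σ = ⟦ e₁ ⟧ σ <ᵇ ⟦ e₂ ⟧ σ

setScalar : Store → ℕ → ℕ → Store
setScalar (store s v m) x k = store (s [ x ↦ k ]) v m

setVector : Store → ℕ → ℕ → ℕ → Store
setVector (store s v m) a i k = store s (v [ a ↦ (v a) [ i ↦ k ] ]) m

setMatrix : Store → ℕ → ℕ → ℕ → ℕ → Store
setMatrix (store s v m) a i j k =
  store s v (m [ a ↦ (m a) [ i ↦ (m a i) [ j ↦ k ] ] ])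

cost : Expr → ℕ
cost (lit k)       = 1
cost (var x)       = 1
cost (vec a e)     = 1 + cost e
cost (mat a e₁ e₂) = 1 + (cost e₁ + cost e₂)
cost (succ e)      = 1 + cost e

costᵗ : Test → ℕ
costᵗ (e₁ ≐ e₂) = 1 + (cost e₁ + cost e₂)
costᵗ (e₁ ≺ e₂) = 1 + (cost e₁ + cost e₂)

-- p , σ ⇓[ t ] τ : started in σ, p halts in τ after exactly t units of time.
infix 3 _,_⇓[_]_

data _,_⇓[_]_ : Program → Store → ℕ → Store → Set where
  ⇓skip : ∀ {σ} → skip , σ ⇓[ 1 ] σ
  ⇓var  : ∀ {σ x e} →
          var≔ x e , σ ⇓[ 1 + cost e ] setScalar σ x (⟦ e ⟧ σ)
  ⇓vec  : ∀ {σ a i e} →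
          vec≔ a i e , σ ⇓[ 1 + (cost i + cost e) ]
            setVector σ a (⟦ i ⟧ σ) (⟦ e ⟧ σ)
  ⇓mat  : ∀ {σ a i j e} →
          mat≔ a i j e , σ ⇓[ 1 + (cost i + (cost j + cost e)) ]
            setMatrix σ a (⟦ i ⟧ σ) (⟦ j ⟧ σ) (⟦ e ⟧ σ)
  ⇓seq  : ∀ {σ τ υ p q t u} → p , σ ⇓[ t ] τ → q , τ ⇓[ u ] υ →
          (p ⨾ q) , σ ⇓[ t + u ] υ
  ⇓then : ∀ {σ τ b p q t} → ⟦ b ⟧ᵗ σ ≡ true → p , σ ⇓[ t ] τ →
          cond b p q , σ ⇓[ costᵗ b + t ] τ
  ⇓else : ∀ {σ τ b p q t} → ⟦ b ⟧ᵗ σ ≡ false → q , σ ⇓[ t ] τ →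
          cond b p q , σ ⇓[ costᵗ b + t ] τ
  ⇓stop : ∀ {σ b p} → ⟦ b ⟧ᵗ σ ≡ false →
          while b p , σ ⇓[ costᵗ b ] σ
  ⇓loop : ∀ {σ τ υ b p t u} → ⟦ b ⟧ᵗ σ ≡ true →
          p , σ ⇓[ t ] τ → while b p , τ ⇓[ u ] υ →
          while b p , σ ⇓[ costᵗ b + (t + u) ] υ

------------------------------------------------------------------------
-- Input and output conventions

bit : Side → ℕ
bit b = if b then 1 else 0

-- Vector a holds the characteristic function of X in cells 0, …, n-1.
HoldsSubset : ∀ {n} → Store → ℕ → Subset n → Set
HoldsSubset {n} σ a X = ∀ (x : Fin n) → vector σ a (toℕ x) ≡ bit (lookup X x)

-- The partition of V∖{v} is stored as row v of matrix 0, which records for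
-- each x ≠ v the position in the list of the class containing x; this is what
-- allows the class of an element to be found in constant time.  All of memory
-- not mentioned here, including the diagonal of matrix 0, is uninitialised.
record Input {n : ℕ} {H : HomogeneousRelation n}
             (P : PartitionLists H) (S : Subset n) (σ : Store) : Set where
  open PartitionLists P
  field
    size       : scalar σ 0 ≡ n
    set        : HoldsSubset σ 0 S
    partitions : ∀ v (k : Fin (length (classes v))) x →
                 x ∈ List.lookup (classes v) k →
                 matrix σ 0 (toℕ v) (toℕ x) ≡ toℕ k

Output : ∀ {n} → Subset n → Store → Set
Output X τ = HoldsSubset τ 1 X

{-# OPTIONS --safe #-}
-- A set M containing S is kept as a queue, initially S. Fix a ∈ M. By
-- transitivity of H_s, a vertex s ∉ M distinguishes M iff H(s|ax) fails for
-- some x ∈ M, so it suffices to compare, for each queued x in turn and each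
-- s ∉ M, the classes of a and x in row s; s is queued if they differ. Such an s
-- lies in every homogeneous set containing M, hence M ⊆ SHS(S) throughout, and
-- once the queue is exhausted M is homogeneous. Each of the |SHS(S)| passes
-- takes O(|V|) time.
module Submission where

open import Defs
open import Data.Bool.Base using (true; false)
open import Data.Bool.Properties using (T-≡)
open import Data.Fin.Base using (Fin; zero; suc; toℕ; fromℕ<)
open import Data.Fin.Properties using (toℕ-injective; toℕ-fromℕ<; toℕ<n; _≟_)
open import Data.Fin.Subset
  using (Subset; Nonempty; ∣_∣; inside; outside; _∈_; _∉_; _⊆_; ⊥)
open import Data.Fin.Subset.Properties
  using (_∈?_; p⊆q⇒∣p∣≤∣q∣; ⊆-antisym; ∣p∣≤n; ∣⊥∣≡0; ∉⊥; ∣⁅x⁆∣≡1; x∈⁅y⁆⇒x≡y)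
import Data.List.Base as List
import Data.List.Relation.Unary.Any as Any
open import Data.List.Relation.Unary.Any.Properties using (lookup-index)
open import Data.Nat.Base
  using (ℕ; zero; suc; _+_; _*_; _⊔_; _≤_; _<_; _≡ᵇ_; _<ᵇ_; z≤n; s≤s)
open import Data.Nat.Properties
  using (≤-refl; ≤-trans; ≤-reflexive; +-mono-≤; +-monoʳ-≤; *-monoʳ-≤; +-assoc;
         +-suc; +-identityʳ; m≤m+n; m≤m⊔n; m≤n⊔m; <-≤-trans; <⇒≤; <⇒≱; <⇒≢; ≮⇒≥;
         <ᵇ⇒<; <⇒<ᵇ; ≡ᵇ⇒≡; ≡⇒≡ᵇ; m≤n⇒m<n∨m≡n; n≮0)
open import Data.Nat.Tactic.RingSolver using (solve-∀)
open import Data.Product.Base using (∃-syntax; _×_; _,_; proj₁; proj₂)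
open import Data.Sum.Base using (inj₁; inj₂)
open import Data.Vec.Base using (_[_]≔_; lookup; tabulate; here; there; _∷_)
open import Data.Vec.Properties
  using (lookup⇒[]=; []=⇒lookup; lookup∘tabulate; lookup∘update; lookup∘update′;
         []≔-updates; []≔-minimal)
open import Function.Base using (_∘_)
open import Function.Bundles using (_⇔_; mk⇔; Equivalence)
open import Relation.Binary.PropositionalEquality
  using (_≡_; _≢_; refl; sym; trans; cong; cong₂; subst; subst₂)
open import Relation.Binary.Structures using (IsEquivalence)
open import Relation.Nullary using (¬_; yes; no; does; contradiction)
open import Relation.Nullary.Decidable using (dec-true; decidable-stable)

open Equivalence using (to; from)

-- Tests, memory updates and subsets

≡ᵇ-true : ∀ {m n} → m ≡ n → (m ≡ᵇ n) ≡ true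
≡ᵇ-true {m} {n} = to T-≡ ∘ ≡⇒≡ᵇ m n

≡ᵇ-true⁻ : ∀ m n → (m ≡ᵇ n) ≡ true → m ≡ n
≡ᵇ-true⁻ m n = ≡ᵇ⇒≡ m n ∘ from T-≡

≡ᵇ-false⁻ : ∀ {m n} → (m ≡ᵇ n) ≡ false → m ≢ n
≡ᵇ-false⁻ eq m≡n with () ← trans (sym eq) (≡ᵇ-true m≡n)

<ᵇ-true⁻ : ∀ m n → (m <ᵇ n) ≡ true → m < n
<ᵇ-true⁻ m n = <ᵇ⇒< m n ∘ from T-≡

<ᵇ-false⁻ : ∀ {m n} → (m <ᵇ n) ≡ false → ¬ m < n
<ᵇ-false⁻ eq m<n with () ← trans (sym eq) (to T-≡ (<⇒<ᵇ m<n))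

bit-≡ᵇ-true : ∀ b → (bit b ≡ᵇ 0) ≡ true → b ≡ false
bit-≡ᵇ-true false _ = refl

bit-≡ᵇ-false : ∀ b → (bit b ≡ᵇ 0) ≡ false → b ≡ true
bit-≡ᵇ-false true _ = refl

module _ {A : Set} (f : ℕ → A) where

  update-same : ∀ {i j a} → j ≡ i → (f [ i ↦ a ]) j ≡ a
  update-same {i} {j} j≡i rewrite ≡ᵇ-true {j} {i} j≡i = refl

  update-other : ∀ {i j a} → j ≢ i → (f [ i ↦ a ]) j ≡ f j
  update-other {i} {j} j≢i with j ≡ᵇ i in eq
  ... | true  = contradiction (≡ᵇ-true⁻ j i eq) j≢i
  ... | false = refl

lookup≡false⇒∉ : ∀ {n} {M : Subset n} {x} → lookup M x ≡ false → x ∉ M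
lookup≡false⇒∉ eq x∈M with () ← trans (sym eq) ([]=⇒lookup x∈M)

∣p[x]≔inside∣ : ∀ {n} (p : Subset n) {x} → x ∉ p → ∣ p [ x ]≔ inside ∣ ≡ suc ∣ p ∣
∣p[x]≔inside∣ (inside  ∷ p) {zero}  x∉p = contradiction here x∉p
∣p[x]≔inside∣ (outside ∷ p) {zero}  x∉p = refl
∣p[x]≔inside∣ (inside  ∷ p) {suc x} x∉p = cong suc (∣p[x]≔inside∣ p (x∉p ∘ there))
∣p[x]≔inside∣ (outside ∷ p) {suc x} x∉p = ∣p[x]≔inside∣ p (x∉p ∘ there)

x∈p⇒0<∣p∣ : ∀ {n} {p : Subset n} {x} → x ∈ p → 0 < ∣ p ∣
x∈p⇒0<∣p∣ {x = x} x∈p = subst (_≤ _) (∣⁅x⁆∣≡1 x) (p⊆q⇒∣p∣≤∣q∣ λ y∈ →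
  subst (_∈ _) (sym (x∈⁅y⁆⇒x≡y x y∈)) x∈p)

-- Total correctness with a time bound

-- Only an upper bound on the exact time is kept, so that branches of unequal cost and loops with an
-- estimated number of passes compose.
record Run (p : Program) (σ : Store) (B : ℕ) (Q : Store → Set) : Set where
  constructor run
  field
    {time}  : ℕ
    {final} : Store
    exec    : p , σ ⇓[ time ] final
    bound   : time ≤ B
    post    : Q final

weaken : ∀ {p σ B} {Q R : Store → Set} → (∀ {τ} → Q τ → R τ) → Run p σ B Q → Run p σ B R
weaken f (run e b q) = run e b (f q)

seqʳ : ∀ {p q σ B C} {Q R : Store → Set} →
       Run p σ B Q → (∀ {τ} → Q τ → Run q τ C R) → Run (p ⨾ q) σ (B + C) R
seqʳ (run e b q) k with k q
... | run e′ b′ r = run (⇓seq e e′) (+-mono-≤ b b′) r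

condʳ : ∀ {b p q σ B C Q} → (⟦ b ⟧ᵗ σ ≡ true → Run p σ B Q) →
        (⟦ b ⟧ᵗ σ ≡ false → Run q σ C Q) → Run (cond b p q) σ (costᵗ b + (B ⊔ C)) Q
condʳ {b} {σ = σ} {B} {C} f g with ⟦ b ⟧ᵗ σ in eq
... | true  with run e l q ← f refl =
  run (⇓then eq e) (+-monoʳ-≤ (costᵗ b) (≤-trans l (m≤m⊔n B C))) q
... | false with run e l q ← g refl =
  run (⇓else eq e) (+-monoʳ-≤ (costᵗ b) (≤-trans l (m≤n⊔m B C))) q

-- `k` counts the passes made; `N` limits them without occurring in the program. Recursion is on the
-- fuel `d`, which is positive whenever the test succeeds, as `k < N ≤ k + d`. The first test is
-- paid for separately, every pass for its body and the next test.
whileʳ : ∀ {b p B N} (Inv : ℕ → Store → Set) →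
         (∀ {k σ} → Inv k σ → ⟦ b ⟧ᵗ σ ≡ true → k < N × Run p σ B (Inv (suc k))) →
         ∀ {k σ} d → N ≤ k + d → Inv k σ →
         Run (while b p) σ (costᵗ b + d * (B + costᵗ b))
           (λ τ → ⟦ b ⟧ᵗ τ ≡ false × ∃[ j ] Inv j τ)
whileʳ {b} {p} {B} {N} Inv step {k} {σ} d N≤ inv with ⟦ b ⟧ᵗ σ in eq
... | false = run (⇓stop eq) (m≤m+n _ _) (eq , k , inv)
... | true  with d | step inv eq
...   | zero   | k<N , _ = contradiction (subst (N ≤_) (+-identityʳ k) N≤) (<⇒≱ k<N)
...   | suc d′ | _ , run e l inv′
  with whileʳ Inv step d′ (subst (N ≤_) (+-suc k d′) N≤) inv′
...     | run e′ l′ post = run (⇓loop eq e e′)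
  (+-monoʳ-≤ (costᵗ b) (≤-trans (+-mono-≤ l l′)
    (≤-reflexive (sym (+-assoc B (costᵗ b) (d′ * (B + costᵗ b))))))) post

-- Scalar 0 holds |V| and scalar 1 the loop variable.
for : Program → Program
for p = var≔ 1 (lit 0) ⨾ while (var 1 ≺ var 0) (p ⨾ var≔ 1 (succ (var 1)))

-- Initialisation costs 2 and the first test 3; a pass adds 3 for the increment and 3 for the next
-- test.
forCost : ℕ → ℕ → ℕ
forCost n B = 2 + (3 + n * (B + 3 + 3))

-- The loop itself writes scalar 1, so the invariant must survive any write there, and the body must
-- leave the loop variable as found.
forʳ : ∀ {p n B σ} (Inv : ℕ → Store → Set) →
       (∀ {i σ} → Inv i σ → scalar σ 0 ≡ n) →
       (∀ {i σ} k → Inv i σ → Inv i (setScalar σ 1 k)) →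
       (∀ {σ} (x : Fin n) → scalar σ 1 ≡ toℕ x → Inv (toℕ x) σ →
         Run p σ B (λ τ → scalar τ 1 ≡ toℕ x × Inv (suc (toℕ x)) τ)) →
       Inv 0 σ → Run (for p) σ (forCost n B) (Inv n)
forʳ {p} {n} {B} Inv size stable body inv =
  seqʳ (run {final = setScalar _ 1 0} ⇓var ≤-refl (refl , z≤n , stable 0 inv)) λ inv₀ →
  weaken exit (whileʳ Counted step n ≤-refl inv₀)
  where
  Counted : ℕ → Store → Set
  Counted i σ = scalar σ 1 ≡ i × i ≤ n × Inv i σ

  at : ∀ {σ} (x : Fin n) → scalar σ 1 ≡ toℕ x → Inv (toℕ x) σ →
       Run (p ⨾ var≔ 1 (succ (var 1))) σ (B + 3) (Counted (suc (toℕ x)))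
  at x i≡x inv = seqʳ (body x i≡x inv) λ (i≡x′ , inv′) →
    run ⇓var ≤-refl (cong suc i≡x′ , toℕ<n x , stable _ inv′)

  step : ∀ {i σ} → Counted i σ → ⟦ var 1 ≺ var 0 ⟧ᵗ σ ≡ true →
         i < n × Run (p ⨾ var≔ 1 (succ (var 1))) σ (B + 3) (Counted (suc i))
  step {i} {σ} (σ1≡i , _ , inv) eq = i<n ,
    subst (λ j → Run _ σ (B + 3) (Counted (suc j))) x≡i
      (at x (trans σ1≡i (sym x≡i)) (subst (λ j → Inv j σ) (sym x≡i) inv))
    where
    i<n : i < n
    i<n = subst₂ _<_ σ1≡i (size inv) (<ᵇ-true⁻ (scalar σ 1) (scalar σ 0) eq)

    x : Fin n
    x = fromℕ< i<n

    x≡i : toℕ x ≡ i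
    x≡i = toℕ-fromℕ< i<n

  -- The failed test excludes `i < n`, and `i ≤ n`, kept in `Counted` for this purpose, leaves
  -- `i = n`.
  exit : ∀ {τ} → ⟦ var 1 ≺ var 0 ⟧ᵗ τ ≡ false × ∃[ i ] Counted i τ → Inv n τ
  exit {τ} (eq , i , τ1≡i , i≤n , inv) with m≤n⇒m<n∨m≡n i≤n
  ... | inj₁ i<n  =
    contradiction (subst₂ _<_ (sym τ1≡i) (sym (size inv)) i<n) (<ᵇ-false⁻ eq)
  ... | inj₂ refl = inv

-- The algorithm

-- Vector 1 marks the members of M. Vector 2 is the queue of all members of M,
-- scalar 2 their number, and scalar 3 the number of those already treated.
push : Program
push = vec≔ 1 (var 1) (lit 1) ⨾ vec≔ 2 (var 2) (var 1) ⨾ var≔ 2 (succ (var 2))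

-- `b` is the condition for leaving an unmarked vertex out: `notInS` makes the scan load `S`,
-- `sameClass` makes it treat one queue entry.
scanBody scan : Test → Program
scanBody b = cond (vec 1 (var 1) ≐ lit 0) (cond b skip push) skip
scan b = for (scanBody b)

-- Testing the mark costs 4, `push` 9 and `skip` 1.
scanCost : ℕ → ℕ → ℕ
scanCost n cb = forCost n (4 + ((cb + 9) ⊔ 1))

-- Queue cell 0 serves as the fixed `a`; cell scalar 3 is the entry under treatment. The tests cost
-- 4 and 9.
notInS sameClass : Test
notInS    = vec 0 (var 1) ≐ lit 0
sameClass = mat 0 (var 1) (vec 2 (lit 0)) ≐ mat 0 (var 1) (vec 2 (var 3))

unmarkAll treatNext algorithm : Program
unmarkAll = for (vec≔ 1 (var 1) (lit 0))
treatNext = scan sameClass ⨾ var≔ 3 (succ (var 3))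
algorithm = unmarkAll ⨾ var≔ 2 (lit 0) ⨾ scan notInS ⨾ var≔ 3 (lit 0) ⨾
            while (var 3 ≺ var 2) treatNext

-- `m` bounds the passes of the main loop and will be the size of `SHS H S`.
totalCost : ℕ → ℕ → ℕ
totalCost n m = forCost n 3 + (2 + (scanCost n 4 + (2 + (3 + m * (scanCost n 9 + 3 + 3)))))

totalCost≤ : ∀ n m → 0 < n → 0 < m → totalCost n m ≤ 88 * (n * m)
totalCost≤ (suc n) (suc m) _ _ =
  -- 88 is the cost at `n = m = 1`. The added polynomial is the exact surplus, which turns the
  -- inequality into an identity.
  ≤-trans (m≤m+n _ (28 * n + 49 * m + 60 * (n * m))) (≤-reflexive (split n m))
  where
  split : ∀ n m → (2 + (3 + suc n * 9)) + (2 + ((2 + (3 + suc n * 23)) +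
                    (2 + (3 + suc m * ((2 + (3 + suc n * 28)) + 3 + 3)))))
                  + (28 * n + 49 * m + 60 * (n * m))
                ≡ 88 * (suc n * suc m)
  split = solve-∀

-- Comparing classes

module _ {n : ℕ} {H : HomogeneousRelation n} (P : PartitionLists H) where
  open HomogeneousRelation H
  open PartitionLists P

  Holds-refl : ∀ {s x} → s ≢ x → Holds s x x
  Holds-refl {s} {x} s≢x = IsEquivalence.refl (equivalence s) {x , s≢x}

  Holds-euclidean : ∀ {s a x y} → Holds s a x → Holds s a y → Holds s x y
  Holds-euclidean {s} {a} {x} {y} hx hy = E.trans {X} {A} {Y} (E.sym {A} {X} hx) hy
    where
    module E = IsEquivalence (equivalence s)
    A X Y : ∃[ z ] s ≢ z
    A = a , proj₁ (reflectless hx)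
    X = x , proj₂ (reflectless hx)
    Y = y , proj₂ (reflectless hy)

  classOf : Fin n → Fin n → Subset n
  classOf s x = tabulate (λ y → does (holds? s x y))

  ∈-classOf : ∀ s x y → y ∈ classOf s x ⇔ Holds s x y
  ∈-classOf s x y = mk⇔ to′ from′
    where
    lookup≡does : lookup (classOf s x) y ≡ does (holds? s x y)
    lookup≡does = lookup∘tabulate (λ y → does (holds? s x y)) y

    to′ : y ∈ classOf s x → Holds s x y
    to′ y∈ with holds? s x y | trans (sym lookup≡does) ([]=⇒lookup y∈)
    ... | yes h | _ = h

    from′ : Holds s x y → y ∈ classOf s x
    from′ h = lookup⇒[]= y _ (trans lookup≡does (dec-true (holds? s x y) h))

  -- `complete` locates the class of `x` in the list; its index there is the number stored in matrix
  -- 0.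
  position : ∀ s x → s ≢ x →
             ∃[ k ] (∀ y → y ∈ List.lookup (classes s) k ⇔ Holds s x y)
  position s x s≢x = Any.index C∈ , λ y →
    subst (λ C → y ∈ C ⇔ Holds s x y) (lookup-index C∈) (∈-classOf s x y)
    where
    C∈ = from (complete s (classOf s x)) (x , s≢x , ∈-classOf s x)

  module _ {S : Subset n} {σ : Store} (input : Input P S σ) where
    open Input input

    -- Equal entries name one position of the list for `s`, so the class found there contains both
    -- vertices.
    sameRow⇒Holds : ∀ {s x y} → s ≢ x → s ≢ y →
      matrix σ 0 (toℕ s) (toℕ x) ≡ matrix σ 0 (toℕ s) (toℕ y) → Holds s x y
    sameRow⇒Holds {s} {x} {y} s≢x s≢y eq =
      let k , ∈k = position s x s≢x
          l , ∈l = position s y s≢y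
          k≡l = toℕ-injective (trans (sym (partitions s k x (from (∈k x) (Holds-refl s≢x))))
                  (trans eq (partitions s l y (from (∈l y) (Holds-refl s≢y)))))
      in to (∈k y) (subst (λ j → y ∈ List.lookup (classes s) j) (sym k≡l)
           (from (∈l y) (Holds-refl s≢y)))

    Holds⇒sameRow : ∀ {s x y} → Holds s x y →
      matrix σ 0 (toℕ s) (toℕ x) ≡ matrix σ 0 (toℕ s) (toℕ y)
    Holds⇒sameRow {s} {x} {y} h =
      let s≢x = proj₁ (reflectless h)
          k , ∈k = position s x s≢x
      in trans (partitions s k x (from (∈k x) (Holds-refl s≢x)))
               (sym (partitions s k y (from (∈k y) h)))

-- Correctness

-- What a scan preserves of its initial store: the queue grows only at its end, so `a` and the entry
-- under treatment stay readable.
record Extends {n : ℕ} (σ : Store) (M : Subset n) (τ : Store) (N : Subset n) : Set where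
  field
    grows  : M ⊆ N
    head   : scalar τ 3 ≡ scalar σ 3
    prefix : ∀ {k} → k < ∣ M ∣ → vector τ 2 k ≡ vector σ 2 k

module _ {n : ℕ} {H : HomogeneousRelation n} (P : PartitionLists H) (S : Subset n) where
  open HomogeneousRelation H

  -- `sound` and `complete` make the first `∣ M ∣` queue cells an enumeration of `M`, without
  -- repetition since there are as many cells as members.
  record Represents (σ : Store) (M : Subset n) : Set where
    field
      input    : Input P S σ
      count    : scalar σ 2 ≡ ∣ M ∣
      marks    : HoldsSubset σ 1 M
      sound    : ∀ {k} → k < ∣ M ∣ → ∃[ x ] (x ∈ M × vector σ 2 k ≡ toℕ x)
      complete : ∀ {x} → x ∈ M → ∃[ k ] (k < ∣ M ∣ × vector σ 2 k ≡ toℕ x)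
      within   : M ⊆ SHS H S

    marked⇒∈ : ∀ {x} → scalar σ 1 ≡ toℕ x →
               ⟦ vec 1 (var 1) ≐ lit 0 ⟧ᵗ σ ≡ false → x ∈ M
    marked⇒∈ {x} i≡x eq = lookup⇒[]= x M (bit-≡ᵇ-false (lookup M x)
      (trans (cong (_≡ᵇ 0) (sym (trans (cong (vector σ 1) i≡x) (marks x)))) eq))

    unmarked⇒∉ : ∀ {x} → scalar σ 1 ≡ toℕ x →
                 ⟦ vec 1 (var 1) ≐ lit 0 ⟧ᵗ σ ≡ true → x ∉ M
    unmarked⇒∉ {x} i≡x eq = lookup≡false⇒∉ (bit-≡ᵇ-true (lookup M x)
      (trans (cong (_≡ᵇ 0) (sym (trans (cong (vector σ 1) i≡x) (marks x)))) eq))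

  open Represents

  -- No field reads scalar 1, so each keeps its type definitionally and only the records are
  -- rebuilt.
  retain₁ : ∀ {σ M} k → Represents σ M → Represents (setScalar σ 1 k) M
  retain₁ k r = record { Represents r ; input = record { Input (input r) } }

  retain₃ : ∀ {σ M} k → Represents σ M → Represents (setScalar σ 3 k) M
  retain₃ k r = record { Represents r ; input = record { Input (input r) } }

  -- As `x ∉ M`, the size grows by exactly one, and the write goes to the first cell past the old
  -- queue.
  pushʳ : ∀ {σ₀ M₀ σ M x} → scalar σ 1 ≡ toℕ x → x ∉ M → x ∈ SHS H S →
          Represents σ M → Extends σ₀ M₀ σ M →
          Run push σ 9 (λ τ → scalar τ 1 ≡ toℕ x ×
            Represents τ (M [ x ]≔ inside) × Extends σ₀ M₀ τ (M [ x ]≔ inside))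
  pushʳ {σ₀} {M₀} {σ} {M} {x} i≡x x∉M x∈SHS r e =
    run {final = τ} (⇓seq ⇓vec (⇓seq ⇓vec ⇓var)) ≤-refl (i≡x , r′ , e′)
    where
    M′ : Subset n
    M′ = M [ x ]≔ inside

    τ : Store
    τ = setScalar (setVector (setVector σ 1 (scalar σ 1) 1) 2 (scalar σ 2) (scalar σ 1))
          2 (suc (scalar σ 2))

    size′ : ∣ M′ ∣ ≡ suc ∣ M ∣
    size′ = ∣p[x]≔inside∣ M x∉M

    M⊆M′ : M ⊆ M′
    M⊆M′ {y} y∈M with y ≟ x
    ... | yes refl = contradiction y∈M x∉M
    ... | no  y≢x  = []≔-minimal M y x y≢x y∈M

    old : ∀ {k} → k < ∣ M ∣ → vector τ 2 k ≡ vector σ 2 k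
    old k<M = update-other (vector σ 2) (λ k≡ → <⇒≢ k<M (trans k≡ (count r)))

    new : vector τ 2 ∣ M ∣ ≡ toℕ x
    new = trans (update-same (vector σ 2) (sym (count r))) i≡x

    marks′ : HoldsSubset τ 1 M′
    marks′ y with y ≟ x
    ... | yes refl = trans (update-same (vector σ 1) (sym i≡x))
                       (cong bit (sym (lookup∘update x M inside)))
    ... | no  y≢x  = trans (update-other (vector σ 1) (λ y≡ → y≢x (toℕ-injective (trans y≡ i≡x))))
                       (trans (marks r y) (cong bit (sym (lookup∘update′ y≢x M inside))))

    ∈M′⁻ : ∀ {y} → y ≢ x → y ∈ M′ → y ∈ M
    ∈M′⁻ {y} y≢x y∈ =
      lookup⇒[]= y M (trans (sym (lookup∘update′ y≢x M inside)) ([]=⇒lookup y∈))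

    sound′ : ∀ {k} → k < ∣ M′ ∣ → ∃[ y ] (y ∈ M′ × vector τ 2 k ≡ toℕ y)
    sound′ {k} k<M′ with m≤n⇒m<n∨m≡n (subst (k <_) size′ k<M′)
    ... | inj₂ refl = x , []≔-updates M x , new
    ... | inj₁ (s≤s k<M) with y , y∈M , eq ← sound r k<M =
      y , M⊆M′ y∈M , trans (old k<M) eq

    complete′ : ∀ {y} → y ∈ M′ → ∃[ k ] (k < ∣ M′ ∣ × vector τ 2 k ≡ toℕ y)
    complete′ {y} y∈ with y ≟ x
    ... | yes refl = ∣ M ∣ , ≤-reflexive (sym size′) , new
    ... | no  y≢x with k , k<M , eq ← complete r (∈M′⁻ y≢x y∈) =
      k , ≤-trans k<M (p⊆q⇒∣p∣≤∣q∣ M⊆M′) , trans (old k<M) eq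

    within′ : M′ ⊆ SHS H S
    within′ {y} y∈ with y ≟ x
    ... | yes refl = x∈SHS
    ... | no  y≢x  = within r (∈M′⁻ y≢x y∈)

    r′ : Represents τ M′
    r′ = record
      { input    = record { Input (input r) }
      ; count    = trans (cong suc (count r)) (sym size′)
      ; marks    = marks′
      ; sound    = sound′
      ; complete = complete′
      ; within   = within′
      }

    e′ : Extends σ₀ M₀ τ M′
    e′ = record
      { grows  = M⊆M′ ∘ Extends.grows e
      ; head   = Extends.head e
      ; prefix = λ k<M₀ → trans (old (<-≤-trans k<M₀ (p⊆q⇒∣p∣≤∣q∣ (Extends.grows e))))
                            (Extends.prefix e k<M₀)
      }

  -- Scanning all vertices

  Scanned : Store → Subset n → (Fin n → Set) → ℕ → Store → Set
  Scanned σ M Good i τ = ∃[ N ]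
    (Represents τ N × Extends σ M τ N × (∀ x → toℕ x < i → x ∉ N → Good x))

  -- `M` may already have grown to `N` when `b` is evaluated at an unmarked vertex: success must
  -- establish `Good`, failure must justify the push. `Good` is claimed only outside the current
  -- set, so later pushes cannot spoil it.
  scanʳ : ∀ {σ M} b (Good : Fin n → Set) →
          (∀ {τ N} x → Represents τ N → Extends σ M τ N → scalar τ 1 ≡ toℕ x → x ∉ N →
            (⟦ b ⟧ᵗ τ ≡ true → Good x) × (⟦ b ⟧ᵗ τ ≡ false → x ∈ SHS H S)) →
          Represents σ M → Run (scan b) σ (scanCost n (costᵗ b)) (Scanned σ M Good n)
  scanʳ {σ} {M} b Good test r = forʳ (Scanned σ M Good)
    (λ (_ , r , _) → Input.size (input r))
    (λ k (N , r , e , good) → N , retain₁ k r , record { Extends e } , good)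
    body
    (M , r , record { grows = λ x → x ; head = refl ; prefix = λ _ → refl } , λ _ ())
    where
    extend : ∀ {N} x → (∀ y → toℕ y < toℕ x → y ∉ N → Good y) → (x ∉ N → Good x) →
             ∀ y → toℕ y < suc (toℕ x) → y ∉ N → Good y
    extend x good goodx y (s≤s y≤x) y∉ with m≤n⇒m<n∨m≡n y≤x
    ... | inj₁ y<x = good y y<x y∉
    ... | inj₂ y≡x with refl ← toℕ-injective y≡x = goodx y∉

    body : ∀ {τ} (x : Fin n) → scalar τ 1 ≡ toℕ x → Scanned σ M Good (toℕ x) τ →
           Run (scanBody b) τ (4 + ((costᵗ b + 9) ⊔ 1))
             (λ υ → scalar υ 1 ≡ toℕ x × Scanned σ M Good (suc (toℕ x)) υ)
    body {τ} x i≡x (N , r , e , good) = condʳ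
      (λ unmarked → let x∉N = unmarked⇒∉ r i≡x unmarked in condʳ
        (λ true → run ⇓skip (≤-refl {1}) (i≡x , N , r , e ,
          extend x good (λ _ → proj₁ (test x r e i≡x x∉N) true)))
        (λ false → weaken
          (λ (i≡x′ , r′ , e′) → i≡x′ , N [ x ]≔ inside , r′ , e′ ,
            -- The push at `x` removes no `y < x` from the set, so a vertex outside the new set was
            -- outside the old one.
            extend x (λ y y<x y∉ → good y y<x (λ y∈ → y∉ (grow y∈ y<x)))
              (λ x∉ → contradiction ([]≔-updates N x) x∉))
          (pushʳ i≡x x∉N (proj₂ (test x r e i≡x x∉N) false) r e)))
      (λ marked → run ⇓skip ≤-refl (i≡x , N , r , e ,
        extend x good (λ x∉N → contradiction (marked⇒∈ r i≡x marked) x∉N)))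
      where
      grow : ∀ {y} → y ∈ N → toℕ y < toℕ x → y ∈ N [ x ]≔ inside
      grow {y} y∈ y<x = []≔-minimal N y x (λ y≡x → <⇒≢ y<x (cong toℕ y≡x)) y∈

  -- Initialisation

  Unmarked : ℕ → Store → Set
  Unmarked i σ = Input P S σ × (∀ (x : Fin n) → toℕ x < i → vector σ 1 (toℕ x) ≡ 0)

  -- Memory starts out arbitrary, so the marks must be cleared. The queue needs no clearing, as only
  -- cells below scalar 2 are read.
  unmarkAllʳ : ∀ {σ} → Input P S σ → Run unmarkAll σ (forCost n 3) (Unmarked n)
  unmarkAllʳ i = forʳ Unmarked (Input.size ∘ proj₁)
    (λ k (i , z) → record { Input i } , z) body (i , λ _ ())
    where
    body : ∀ {σ} (x : Fin n) → scalar σ 1 ≡ toℕ x → Unmarked (toℕ x) σ →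
           Run (vec≔ 1 (var 1) (lit 0)) σ 3
             (λ τ → scalar τ 1 ≡ toℕ x × Unmarked (suc (toℕ x)) τ)
    body {σ} x i≡x (i , z) =
      run {final = setVector σ 1 (scalar σ 1) 0} ⇓vec ≤-refl (i≡x , record { Input i } , z′)
      where
      z′ : ∀ (y : Fin n) → toℕ y < suc (toℕ x) →
           ((vector σ 1) [ scalar σ 1 ↦ 0 ]) (toℕ y) ≡ 0
      z′ y (s≤s y≤x) with m≤n⇒m<n∨m≡n y≤x
      ... | inj₁ y<x = trans (update-other (vector σ 1) (λ y≡ → <⇒≢ y<x (trans y≡ i≡x))) (z y y<x)
      ... | inj₂ y≡x = update-same (vector σ 1) (trans y≡x (sym i≡x))

  empty : ∀ {σ} → Unmarked n σ → Represents (setScalar σ 2 0) ⊥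
  empty {σ} (i , z) = record
    { input    = record { Input i }
    ; count    = sym (∣⊥∣≡0 n)
    ; marks    = λ x → trans (z x (toℕ<n x)) (cong bit (sym (unmarked x)))
    ; sound    = λ k<0 → contradiction (subst (_ <_) (∣⊥∣≡0 n) k<0) n≮0
    ; complete = λ x∈⊥ → contradiction x∈⊥ ∉⊥
    ; within   = λ x∈⊥ → contradiction x∈⊥ ∉⊥
    }
    where
    unmarked : ∀ x → lookup (⊥ {n}) x ≡ outside
    unmarked x with lookup (⊥ {n}) x in eq
    ... | true  = contradiction (lookup⇒[]= x ⊥ eq) ∉⊥
    ... | false = refl

  -- With `_∉ S` as `Good`, every vertex left outside is outside `S`, whence `S` is contained in the
  -- final set.
  scanSʳ : ∀ {σ M} → Represents σ M →
           Run (scan notInS) σ (scanCost n 4) (Scanned σ M (_∉ S) n)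
  scanSʳ = scanʳ notInS (_∉ S) λ {τ} x r _ i≡x _ →
    let v0 = trans (cong (vector τ 0) i≡x) (Input.set (input r) x)
    in (λ t → lookup≡false⇒∉ (bit-≡ᵇ-true (lookup S x) (trans (cong (_≡ᵇ 0) (sym v0)) t)))
     , (λ f → S⊆SHS H S (lookup⇒[]= x S (bit-≡ᵇ-false (lookup S x)
                 (trans (cong (_≡ᵇ 0) (sym v0)) f))))

  -- The main loop

  Treated : Fin n → Subset n → Fin n → Set
  Treated a M x = ∀ s → s ∉ M → Holds s a x

  record Progress (a : Fin n) (h : ℕ) (σ : Store) : Set where
    field
      members    : Subset n
      represents : Represents σ members
      first      : vector σ 2 0 ≡ toℕ a
      a∈M        : a ∈ members
      S⊆M        : S ⊆ members
      head       : scalar σ 3 ≡ h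
      treated    : ∀ {k} x → k < h → vector σ 2 k ≡ toℕ x → Treated a members x

  module _ (nonempty : Nonempty S) where

    -- Otherwise `s` would distinguish the homogeneous set `SHS H S` through its members `a` and
    -- `x`.
    split⇒∈SHS : ∀ {M a x s} → M ⊆ SHS H S → a ∈ M → x ∈ M → ¬ Holds s a x → s ∈ SHS H S
    split⇒∈SHS {a = a} {x} {s} M⊆ a∈M x∈M ¬h = decidable-stable (s ∈? SHS H S) λ s∉ →
      proj₂ (SHS-homogeneous H S nonempty) s s∉ (a , x , M⊆ a∈M , M⊆ x∈M , ¬h)

    -- If all members are equivalent to `a` for each outside `s`, they are equivalent to each other,
    -- so `M` is homogeneous and minimality applies.
    treated⇒SHS : ∀ {M a} → a ∈ M → S ⊆ M → M ⊆ SHS H S →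
                  (∀ {x} → x ∈ M → Treated a M x) → M ≡ SHS H S
    treated⇒SHS {M} {a} a∈M S⊆M M⊆ treated = ⊆-antisym M⊆ λ x∈ →
      x∈SHS⁻ H S x∈ M
        ( (a , a∈M)
        , λ s s∉M (x , y , x∈M , y∈M , ¬h) →
            ¬h (Holds-euclidean P (treated x∈M s s∉M) (treated y∈M s s∉M)) )
        S⊆M

    scanClassʳ : ∀ {σ M a x} → Represents σ M → vector σ 2 0 ≡ toℕ a → a ∈ M →
                 scalar σ 3 < ∣ M ∣ → vector σ 2 (scalar σ 3) ≡ toℕ x → x ∈ M →
                 Run (scan sameClass) σ (scanCost n 9) (Scanned σ M (λ s → Holds s a x) n)
    scanClassʳ {σ} {M} {a} {x} r first a∈M h<M current x∈M =
      scanʳ sameClass (λ s → Holds s a x) test r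
      where
      test : ∀ {τ N} s → Represents τ N → Extends σ M τ N → scalar τ 1 ≡ toℕ s → s ∉ N →
             (⟦ sameClass ⟧ᵗ τ ≡ true → Holds s a x) ×
             (⟦ sameClass ⟧ᵗ τ ≡ false → s ∈ SHS H S)
      test {τ} {N} s r′ e i≡s s∉N =
          (λ t → sameRow⇒Holds P (input r′)
                   (λ { refl → s∉N (grows a∈M) }) (λ { refl → s∉N (grows x∈M) })
                   (trans (sym left) (trans (≡ᵇ-true⁻ _ _ t) right)))
        , (λ f → split⇒∈SHS (within r′) (grows a∈M) (grows x∈M) λ h →
                   ≡ᵇ-false⁻ f (trans left (trans (Holds⇒sameRow P (input r′) h) (sym right))))
        where
        open Extends e using (grows; prefix) renaming (head to sameHead)

        left : ⟦ mat 0 (var 1) (vec 2 (lit 0)) ⟧ τ ≡ matrix τ 0 (toℕ s) (toℕ a)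
        left = cong₂ (matrix τ 0) i≡s (trans (prefix (<-≤-trans (s≤s z≤n) h<M)) first)

        right : ⟦ mat 0 (var 1) (vec 2 (var 3)) ⟧ τ ≡ matrix τ 0 (toℕ s) (toℕ x)
        right = cong₂ (matrix τ 0) i≡s
          (trans (cong (vector τ 2) sameHead) (trans (prefix h<M) current))

    -- Entry `h` lies in the queue of a subset of `SHS H S`; hence the number of passes is bounded
    -- by the size of the answer.
    treatNextʳ : ∀ {a h σ} → Progress a h σ → ⟦ var 3 ≺ var 2 ⟧ᵗ σ ≡ true →
                 h < ∣ SHS H S ∣ × Run treatNext σ (scanCost n 9 + 3) (Progress a (suc h))
    treatNextʳ {a} {h} {σ} progress h<count =
      let x , x∈M , current = sound represents h<M in
      subst (_< ∣ SHS H S ∣) head (<-≤-trans h<M (p⊆q⇒∣p∣≤∣q∣ (within represents))) ,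
      seqʳ (scanClassʳ represents first a∈M h<M current x∈M) λ {τ} (N , r , e , good) →
        run {final = setScalar τ 3 (suc (scalar τ 3))} ⇓var ≤-refl (advance x current r e good)
      where
      open Progress progress

      h<M : scalar σ 3 < ∣ members ∣
      h<M = subst (scalar σ 3 <_) (count represents) (<ᵇ-true⁻ _ (scalar σ 2) h<count)

      advance : ∀ {τ N} x → vector σ 2 (scalar σ 3) ≡ toℕ x → Represents τ N →
                Extends σ members τ N → (∀ s → toℕ s < n → s ∉ N → Holds s a x) →
                Progress a (suc h) (setScalar τ 3 (suc (scalar τ 3)))
      advance {τ} {N} x current r e good = record
        { members    = N
        ; represents = retain₃ _ r
        ; first      = trans (prefix (<-≤-trans (s≤s z≤n) h<M)) first
        ; a∈M        = grows a∈M
        ; S⊆M        = grows ∘ S⊆M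
        ; head       = cong suc (trans sameHead head)
        ; treated    = treated′
        }
        where
        open Extends e using (grows; prefix) renaming (head to sameHead)

        treated′ : ∀ {k} y → k < suc h → vector τ 2 k ≡ toℕ y → Treated a N y
        treated′ {k} y (s≤s k≤h) eq s s∉N with m≤n⇒m<n∨m≡n k≤h
        -- Growth of the set leaves fewer `s` to check, so an entry once treated stays treated.
        ... | inj₁ k<h = treated y k<h
          (trans (sym (prefix (<-≤-trans k<h (≤-trans (≤-reflexive (sym head)) (<⇒≤ h<M))))) eq)
          s (s∉N ∘ grows)
        -- `y` is read from the same queue cell as `x`, which the scan has just treated.
        ... | inj₂ refl =
          subst (Holds s a) (toℕ-injective (trans (sym current)
            (trans (sym (prefix h<M)) (trans (cong (vector τ 2) head) eq)))) (good s (toℕ<n s) s∉N)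

    -- The failed test gives `∣ M ∣ ≤ h`, so each member sits at a treated position.
    exhausted : ∀ {a h τ} → ⟦ var 3 ≺ var 2 ⟧ᵗ τ ≡ false → Progress a h τ →
                Output (SHS H S) τ
    exhausted {a} {h} {τ} done progress =
      subst (HoldsSubset τ 1) M≡SHS (marks represents)
      where
      open Progress progress

      M≡SHS : members ≡ SHS H S
      M≡SHS = treated⇒SHS a∈M S⊆M (within represents) λ {x} x∈M →
        let k , k<M , eq = complete represents x∈M
        in treated x (<-≤-trans k<M (subst₂ _≤_ (count represents) head
             (≮⇒≥ (<ᵇ-false⁻ done)))) eq

    algorithmʳ : ∀ {σ} → Input P S σ →
                 Run algorithm σ (totalCost n ∣ SHS H S ∣) (Output (SHS H S))
    algorithmʳ i =
      seqʳ (unmarkAllʳ i) λ unmarked →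
      seqʳ {Q = λ τ → Represents τ ⊥} (run ⇓var ≤-refl (empty unmarked)) λ r₀ →
      seqʳ (scanSʳ r₀) λ (_ , r , _ , good) →
      seqʳ {Q = λ τ → ∃[ a ] Progress a 0 τ} (run ⇓var ≤-refl (start r good)) λ (_ , progress) →
      weaken (λ (done , _ , progress) → exhausted done progress)
        (whileʳ {N = ∣ SHS H S ∣} (Progress _) treatNextʳ ∣ SHS H S ∣ ≤-refl progress)
      where
      start : ∀ {τ N} → Represents τ N → (∀ x → toℕ x < n → x ∉ N → x ∉ S) →
              ∃[ a ] Progress a 0 (setScalar τ 3 0)
      start {N = N} r good =
        let S⊆N = λ {x} (x∈S : x ∈ S) →
              decidable-stable (x ∈? N) λ x∉N → good x (toℕ<n x) x∉N x∈S
            _ , k<N , _ = complete r (S⊆N (proj₂ nonempty))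
            -- The queue is not empty because `S` is not, so its cell 0 holds a member to serve as
            -- `a`.
            a , a∈N , first = sound r (<-≤-trans (s≤s z≤n) k<N)
        in a , record
          { members    = N
          ; represents = retain₃ 0 r
          ; first      = first
          ; a∈M        = a∈N
          ; S⊆M        = S⊆N
          ; head       = refl
          ; treated    = λ _ ()
          }

mainTheorem11 : ∃[ p ] ∃[ c ]
    (∀ (n : ℕ) (H : HomogeneousRelation n) (P : PartitionLists H)
    (S : Subset n) → Nonempty S →
    ∀ (σ : Store) → Input P S σ →
    ∃[ t ] ∃[ τ ]
    ( (p , σ ⇓[ t ] τ)
    × Output (SHS H S) τ
    × t ≤ c * (n * ∣ SHS H S ∣)
    × t ≤ c * (n * n) ))
mainTheorem11 = algorithm , 88 , λ n H P S nonempty σ input →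
  let run {t} {τ} exec bound output = algorithmʳ P S nonempty input
      m≤n = ∣p∣≤n (SHS H S)
      -- Positivity of both factors lets the product absorb the constant and linear terms of the
      -- cost.
      0<m = x∈p⇒0<∣p∣ (S⊆SHS H S (proj₂ nonempty))
      t≤ = ≤-trans bound (totalCost≤ n ∣ SHS H S ∣ (<-≤-trans 0<m m≤n) 0<m)
  in t , τ , exec , output , t≤ , ≤-trans t≤ (*-monoʳ-≤ 88 (*-monoʳ-≤ n m≤n))
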